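{- Let $n,\lambda$ be positive integers. If there exists a generalized Hadamard matrix GH$(n,\lambda)$ (over some finite abelian group of order $n$), then there exists a full pairwise additive BIB design (full PAB) with parameters $$v^\ast=n\lambda,\quad b^\ast=n(n\lambda-1),\quad r^\ast=n\lambda-1,\quad k^\ast=\lambda,\quad \lambda^\ast=\lambda-1.$$
   Context: Generalized Hadamard matrices. Let $G$ be a finite abelian group of order $n$, written additively. A difference matrix DM$(n,k,\lambda)$ based on $G$ is a $k\times n\lambda$ matrix $(a_{ij})$ with entries from $G$ such that, for all $1\le i_1<i_2\le k$, the multiset $\{a_{i_1j}-a_{i_2j}\mid j=1,\dots,n\lambda\}$ contains every element of $G$ exactly $\lambda$ times. A generalized Hadamard matrix GH$(n,\lambda)$ is a DM$(n,n\lambda,\lambda)$, i.e. a difference matrix of size $n\lambda\times n\lambda$. All difference matrices are over abelian groups. Block designs. A block design BD$(v,b,r,k)$ consists of a set $V$ of $v$ points and a family (repetitions allowed) of $b$ blocks, each block being a set of $k$ different points, such that each point lies in exactly $r$ blocks. Its incidence matrix is the $v\times b$ $(0,1)$-matrix whose $(i,j)$ entry is $1$ if and only if the $i$-th point lies in the $j$-th block. A BD$(v,b,r,k)$ is a balanced incomplete block (BIB) design BIBD$(v,b,r,k,\lambda)$ if any two different points lie together in exactly $\lambda$ blocks. (Degenerate cases such as $k=1$, $\lambda=0$ and $k=v$ are allowed.) Pairwise additive BIB designs. A PAB$(\ell;v,k,\lambda)$, with associated $b$ and $r$, is a set of $\ell$ matrices $N_1,\dots,N_\ell$ of size $v\times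 b$, $N_h=(a^{(h)}_{ij})$, such that each $N_h$ is the incidence matrix of a BIBD$(v,b,r,k,\lambda)$, $a^{(h_1)}_{ij}a^{(h_2)}_{ij}=0$ for all $i,j$ and all distinct $h_1,h_2$, and for all distinct $h_1,h_2$ the matrix $N_{h_1}+N_{h_2}$ is the incidence matrix of a BIBD with parameters $(v,\,b,\,2r,\,2k,\,2r(2k-1)/(v-1))$. A full PAB with parameters $v,b,r,k,\lambda$ is a PAB$(\ell;v,k,\lambda)$ (with these $b$ and $r$) for which $\ell=v/k$. -}

module Defs where

open import Level using (suc; _⊔_)
open import Algebra.Bundles using (AbelianGroup)
open import Data.Fin using (Fin; _<_)
open import Data.Fin.Subset using (Subset; _∈_; ∣_∣)
open import Data.Fin.Subset.Properties using (_∈?_)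
open import Data.Nat using (ℕ; _+_; _*_; _∸_)
open import Data.Product using (_×_; ∃-syntax)
open import Data.Sum using (_⊎_)
open import Data.Vec using (count; tabulate; allFin)
open import Function.Bundles using (Inverse; _⇔_)
open import Function.Properties.Inverse using (Inverse⇒Injection)
open import Relation.Binary.Definitions using (Decidable)
open import Relation.Binary.PropositionalEquality using (_≡_; _≢_)
open import Relation.Nullary.Decidable using (via-injection; _×-dec_)
import Data.Fin as Fin
import Relation.Binary.PropositionalEquality as ≡

Matrix : ∀ {a} → Set a → ℕ → ℕ → Set a
Matrix A m n = Fin m → Fin n → A

record FiniteAbelianGroup c ℓ (n : ℕ) : Set (suc (c ⊔ ℓ)) where
  field
    abelianGroup : AbelianGroup c ℓ
  open AbelianGroup abelianGroup public
  field
    enumeration : Inverse setoid (≡.setoid (Fin n))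

  infix 4 _≈?_
  _≈?_ : Decidable _≈_
  _≈?_ = via-injection (Inverse⇒Injection enumeration) Fin._≟_

module _ {c ℓ n} (G : FiniteAbelianGroup c ℓ n) where
  open FiniteAbelianGroup G

  IsDifferenceMatrix : ∀ k μ → Matrix Carrier k (n * μ) → Set c
  IsDifferenceMatrix k μ A =
    ∀ i₁ i₂ → i₁ < i₂ →
    ∀ g → count (_≈? g) (tabulate (λ j → A i₁ j - A i₂ j)) ≡ μ

  IsGeneralizedHadamard : ∀ μ → Matrix Carrier (n * μ) (n * μ) → Set c
  IsGeneralizedHadamard μ = IsDifferenceMatrix (n * μ) μ

GH : ∀ c ℓ → ℕ → ℕ → Set (suc (c ⊔ ℓ))
GH c ℓ n μ =
  ∃[ G ] ∃[ A ] IsGeneralizedHadamard {c} {ℓ} {n} G μ A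

record IsBlockDesign (v b r k : ℕ) (B : Fin b → Subset v) : Set where
  field
    blockSize   : ∀ j → ∣ B j ∣ ≡ k
    replication : ∀ i → count (λ j → i ∈? B j) (allFin b) ≡ r

record IsBIBD (v b r k μ : ℕ) (B : Fin b → Subset v) : Set where
  field
    isBlockDesign : IsBlockDesign v b r k B
    balance       : ∀ i₁ i₂ → i₁ ≢ i₂ →
      count (λ j → (i₁ ∈? B j) ×-dec (i₂ ∈? B j)) (allFin b) ≡ μ

  open IsBlockDesign isBlockDesign public

IsIncidenceMatrix : ∀ {v b} → (Fin b → Subset v) → Matrix ℕ v b → Set
IsIncidenceMatrix B N =
  ∀ i j → (N i j ≡ 0 ⊎ N i j ≡ 1) × (N i j ≡ 1 ⇔ i ∈ B j)

IsBIBDMatrix : ∀ v b r k μ → Matrix ℕ v b → Set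
IsBIBDMatrix v b r k μ N =
  ∃[ B ] IsBIBD v b r k μ B × IsIncidenceMatrix B N

record IsPAB (ℓ v b r k μ : ℕ) (N : Fin ℓ → Matrix ℕ v b) : Set where
  field
    isBIBD   : ∀ h → IsBIBDMatrix v b r k μ (N h)
    disjoint : ∀ h₁ h₂ → h₁ ≢ h₂ → ∀ i j → N h₁ i j * N h₂ i j ≡ 0
    -- The index μ₊ of the sum is the exact quotient 2r(2k − 1)/(v − 1),
    -- which is required to be a natural number.
    additive : ∀ h₁ h₂ → h₁ ≢ h₂ →
      ∃[ μ₊ ] μ₊ * (v ∸ 1) ≡ 2 * r * (2 * k ∸ 1) ×
              IsBIBDMatrix v b (2 * r) (2 * k) μ₊ (λ i j → N h₁ i j + N h₂ i j)

-- The number ℓ of matrices is v / k, as an exact quotient.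
FullPAB : (v b r k μ : ℕ) → Set
FullPAB v b r k μ =
  ∃[ ℓ ] ∃[ N ] ℓ * k ≡ v × IsPAB ℓ v b r k μ N

{-# OPTIONS --safe #-}

-- Let c (j₁ , j₂ , g) be the number of rows i with a_{i j₁} − a_{i j₂} = g.
-- The sum of c² over all j₁, j₂, g counts the solutions of
-- a_{i₁ j₁} − a_{i₁ j₂} = a_{i₂ j₁} − a_{i₂ j₂}, a condition that is symmetric
-- under transposition, so it equals the sum of the squares of the row counts,
-- which are known.  Hence the variance of c around the value expected of a
-- generalized Hadamard matrix is zero, and the transpose of a generalized
-- Hadamard matrix is one as well.
--
-- After subtracting the first row, the points of the design are the columns j,
-- the blocks are the pairs (g , i) with i a row other than the first, and the
-- h-th design contains j in (g , i) when h − a_{i j} = g.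

module Submission where

open import Defs
open import Data.Bool using (true; false; if_then_else_)
open import Data.Fin as Fin using (Fin; zero; suc; _↑ˡ_; _↑ʳ_; combine; remQuot)
import Data.Fin.Properties as Fin
open import Data.Fin.Subset using (Subset; inside; _∈_)
open import Data.Fin.Subset.Properties using (_∈?_)
open import Data.Nat using (ℕ; zero; suc; _+_; _*_; _∸_; NonZero; ∣_-_∣)
open import Data.Nat.Properties
open import Data.Nat.Tactic.RingSolver using (solve-∀)
open import Data.Product using (_×_; _,_)
open import Data.Sum using (_⊎_; inj₁; inj₂)
open import Data.Vec using (count; tabulate)
open import Data.Vec.Properties using (lookup∘tabulate; []=⇒lookup; lookup⇒[]=)
open import Function using (_∘_; id)
open import Function.Bundles using (Inverse; mk⇔)
open import Level using (Level)
open import Relation.Binary.Definitions using (tri<; tri≈; tri>)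
open import Relation.Binary.PropositionalEquality
open import Relation.Nullary.Decidable using (_×-dec_)
open import Relation.Nullary using (Dec; does; yes; no; ¬_; contradiction)
open import Relation.Unary using (Pred; Decidable)
import Algebra.Properties.AbelianGroup as AbelianGroupProperties
import Data.Bool.Properties as Bool
open import Algebra.Properties.Semiring.Sum +-*-semiring
  using (sum; sum-syntax; sum-cong-≗; sum-replicate-zero; ∑-comm; ∑-distrib-+;
         *-distribˡ-sum; *-distribʳ-sum)

private variable
  p q r : Level
  P : Set p
  Q : Set q
  R : Set r
  m n : ℕ

-- Sums of natural numbers

sum-const : ∀ n x → ∑[ i < n ] x ≡ n * x
sum-const zero    x = refl
sum-const (suc n) x = cong (x +_) (sum-const n x)

sum≡0⇒≡0 : (f : Fin n → ℕ) → sum f ≡ 0 → ∀ i → f i ≡ 0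
sum≡0⇒≡0 f eq zero    = m+n≡0⇒m≡0 (f zero) eq
sum≡0⇒≡0 f eq (suc i) = sum≡0⇒≡0 (f ∘ suc) (m+n≡0⇒n≡0 (f zero) eq) i

sum-↑ : ∀ m {n} (f : Fin (m + n) → ℕ) → sum f ≡ sum (f ∘ (_↑ˡ n)) + sum (f ∘ (m ↑ʳ_))
sum-↑ zero    f = refl
sum-↑ (suc m) f = trans (cong (f zero +_) (sum-↑ m (f ∘ suc))) (sym (+-assoc (f zero) _ _))

sum-combine : ∀ m {n} (f : Fin (m * n) → ℕ) → sum f ≡ ∑[ i < m ] ∑[ j < n ] f (combine i j)
sum-combine zero        f = refl
sum-combine (suc m) {n} f = trans (sum-↑ n f) (cong (sum (f ∘ (_↑ˡ m * n)) +_) (sum-combine m (f ∘ (n ↑ʳ_))))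

sum-remQuot : ∀ m n (f : Fin m × Fin n → ℕ) →
              ∑[ s < m * n ] f (remQuot n s) ≡ ∑[ i < m ] ∑[ j < n ] f (i , j)
sum-remQuot m n f = trans (sum-combine m _)
  (sum-cong-≗ λ i → sum-cong-≗ λ j → cong f (Fin.remQuot-combine i j))

sum-*-sum : (f : Fin m → ℕ) (g : Fin n → ℕ) → sum f * sum g ≡ ∑[ i < m ] ∑[ j < n ] (f i * g j)
sum-*-sum f g = trans (*-distribʳ-sum (sum g) f) (sum-cong-≗ λ i → *-distribˡ-sum (f i) g)

∑₂-cong : {f g : Fin m → Fin n → ℕ} → (∀ i j → f i j ≡ g i j) →
          ∑[ i < m ] ∑[ j < n ] f i j ≡ ∑[ i < m ] ∑[ j < n ] g i j
∑₂-cong f≗g = sum-cong-≗ λ i → sum-cong-≗ (f≗g i)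

∑₂-interchange : (f : Fin m → Fin m → Fin n → Fin n → ℕ) →
  ∑[ i < m ] ∑[ i′ < m ] ∑[ j < n ] ∑[ j′ < n ] f i i′ j j′ ≡
  ∑[ j < n ] ∑[ j′ < n ] ∑[ i < m ] ∑[ i′ < m ] f i i′ j j′
∑₂-interchange {m} {n} f = begin
  ∑[ i < m ] ∑[ i′ < m ] ∑[ j < n ] ∑[ j′ < n ] f i i′ j j′
    ≡⟨ sum-cong-≗ (λ i → ∑-comm λ i′ j → ∑[ j′ < n ] f i i′ j j′) ⟩
  ∑[ i < m ] ∑[ j < n ] ∑[ i′ < m ] ∑[ j′ < n ] f i i′ j j′
    ≡⟨ ∑-comm (λ i j → ∑[ i′ < m ] ∑[ j′ < n ] f i i′ j j′) ⟩
  ∑[ j < n ] ∑[ i < m ] ∑[ i′ < m ] ∑[ j′ < n ] f i i′ j j′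
    ≡⟨ ∑₂-cong (λ j i → ∑-comm λ i′ j′ → f i i′ j j′) ⟩
  ∑[ j < n ] ∑[ i < m ] ∑[ j′ < n ] ∑[ i′ < m ] f i i′ j j′
    ≡⟨ sum-cong-≗ (λ j → ∑-comm λ i j′ → ∑[ i′ < m ] f i i′ j j′) ⟩
  ∑[ j < n ] ∑[ j′ < n ] ∑[ i < m ] ∑[ i′ < m ] f i i′ j j′ ∎
  where open ≡-Reasoning

-- The binomial formula for the square of a difference, with the cross term moved to the left so
-- that nothing is subtracted in the naturals. The induction lowers both arguments at once, which
-- keeps their distance.
∣-∣²-expand : ∀ x y → ∣ x - y ∣ * ∣ x - y ∣ + 2 * (x * y) ≡ x * x + y * y
∣-∣²-expand zero    y       = +-identityʳ (y * y)
∣-∣²-expand (suc x) zero    = lemma x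
  where
  lemma : ∀ x → suc x * suc x + 2 * (suc x * 0) ≡ suc x * suc x + 0
  lemma = solve-∀
∣-∣²-expand (suc x) (suc y) = begin
  d * d + 2 * (suc x * suc y)                ≡⟨ expand d x y ⟩
  (d * d + 2 * (x * y)) + (2 + 2 * x + 2 * y) ≡⟨ cong (_+ (2 + 2 * x + 2 * y)) (∣-∣²-expand x y) ⟩
  (x * x + y * y) + (2 + 2 * x + 2 * y)       ≡⟨ collect x y ⟩
  suc x * suc x + suc y * suc y              ∎
  where
  open ≡-Reasoning
  d = ∣ x - y ∣
  expand : ∀ d x y → d * d + 2 * (suc x * suc y) ≡ (d * d + 2 * (x * y)) + (2 + 2 * x + 2 * y)
  expand = solve-∀
  collect : ∀ x y → (x * x + y * y) + (2 + 2 * x + 2 * y) ≡ suc x * suc x + suc y * suc y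
  collect = solve-∀

-- Pythagoras: the hypothesis says that `c - t`, taken over the integers, is orthogonal to `t`.
variance-expand : (c t : Fin n → ℕ) → ∑[ k < n ] (c k * t k) ≡ ∑[ k < n ] (t k * t k) →
  ∑[ k < n ] (∣ c k - t k ∣ * ∣ c k - t k ∣) + ∑[ k < n ] (t k * t k) ≡ ∑[ k < n ] (c k * c k)
variance-expand {n} c t ct≡tt = +-cancelʳ-≡ T _ _ (begin
  D + T + T                                          ≡⟨ shape D T ⟩
  D + 2 * T                                          ≡⟨ cong (λ x → D + 2 * x) ct≡tt ⟨
  D + 2 * ∑[ k < n ] (c k * t k)                     ≡⟨ cong (D +_) (*-distribˡ-sum 2 λ k → c k * t k) ⟩
  D + ∑[ k < n ] (2 * (c k * t k))                   ≡⟨ ∑-distrib-+ (λ k → d k * d k) (λ k → 2 * (c k * t k)) ⟨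
  ∑[ k < n ] (d k * d k + 2 * (c k * t k))           ≡⟨ sum-cong-≗ (λ k → ∣-∣²-expand (c k) (t k)) ⟩
  ∑[ k < n ] (c k * c k + t k * t k)                 ≡⟨ ∑-distrib-+ (λ k → c k * c k) (λ k → t k * t k) ⟩
  ∑[ k < n ] (c k * c k) + T                         ∎)
  where
  open ≡-Reasoning
  d = λ k → ∣ c k - t k ∣
  D = ∑[ k < n ] (d k * d k)
  T = ∑[ k < n ] (t k * t k)
  shape : ∀ x y → x + y + y ≡ x + 2 * y
  shape = solve-∀

-- Orthogonality is asked for each pair `i`, `j`, but the squares need only agree in total: the
-- squared distances then sum to zero, and a vanishing sum of naturals has only vanishing terms.
variance≡0 : ∀ {l} (c t : Fin m → Fin n → Fin l → ℕ) →
  (∀ i j → ∑[ k < l ] (c i j k * t i j k) ≡ ∑[ k < l ] (t i j k * t i j k)) →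
  ∑[ i < m ] ∑[ j < n ] ∑[ k < l ] (c i j k * c i j k) ≡
  ∑[ i < m ] ∑[ j < n ] ∑[ k < l ] (t i j k * t i j k) →
  ∀ i j k → c i j k ≡ t i j k
variance≡0 {m} {n} {l} c t ct≡tt cc≡tt i j k =
  ∣m-n∣≡0⇒m≡n (m*m≡0⇒m≡0 (sum≡0⇒≡0 _ (sum≡0⇒≡0 _ (sum≡0⇒≡0 _ total≡0 i) j) k))
  where
  open ≡-Reasoning
  m*m≡0⇒m≡0 : ∀ {x} → x * x ≡ 0 → x ≡ 0
  m*m≡0⇒m≡0 {zero} _ = refl
  D = λ i j → ∑[ k < l ] (∣ c i j k - t i j k ∣ * ∣ c i j k - t i j k ∣)
  T = λ i j → ∑[ k < l ] (t i j k * t i j k)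
  total≡0 : ∑[ i < m ] ∑[ j < n ] D i j ≡ 0
  total≡0 = +-cancelʳ-≡ (∑[ i < m ] ∑[ j < n ] T i j) _ _ (begin
    ∑[ i < m ] ∑[ j < n ] D i j + ∑[ i < m ] ∑[ j < n ] T i j
      ≡⟨ ∑-distrib-+ (λ i → sum (D i)) (λ i → sum (T i)) ⟨
    ∑[ i < m ] (sum (D i) + sum (T i))
      ≡⟨ sum-cong-≗ (λ i → sym (∑-distrib-+ (D i) (T i))) ⟩
    ∑[ i < m ] ∑[ j < n ] (D i j + T i j)
      ≡⟨ ∑₂-cong (λ i j → variance-expand (c i j) (t i j) (ct≡tt i j)) ⟩
    ∑[ i < m ] ∑[ j < n ] ∑[ k < l ] (c i j k * c i j k)
      ≡⟨ cc≡tt ⟩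
    ∑[ i < m ] ∑[ j < n ] T i j ∎)

-- Indicators

𝟙 : Dec P → ℕ
𝟙 P? = if does P? then 1 else 0

𝟙-yes : (P? : Dec P) → P → 𝟙 P? ≡ 1
𝟙-yes (yes _) _ = refl
𝟙-yes (no ¬p) p = contradiction p ¬p

𝟙-no : (P? : Dec P) → ¬ P → 𝟙 P? ≡ 0
𝟙-no (yes p) ¬p = contradiction p ¬p
𝟙-no (no _)  _  = refl

𝟙-cong : (P? : Dec P) (Q? : Dec Q) → (P → Q) → (Q → P) → 𝟙 P? ≡ 𝟙 Q?
𝟙-cong (yes p) Q? f g = sym (𝟙-yes Q? (f p))
𝟙-cong (no ¬p) Q? f g = sym (𝟙-no Q? (¬p ∘ g))

𝟙-× : (P? : Dec P) (Q? : Dec Q) → 𝟙 (P? ×-dec Q?) ≡ 𝟙 P? * 𝟙 Q?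
𝟙-× (yes _) (yes _) = refl
𝟙-× (yes _) (no _)  = refl
𝟙-× (no _)  _       = refl

𝟙-*-cong : (P? : Dec P) (Q? : Dec Q) (R? : Dec R) →
           (P → Q → R) → (P → R → Q) → 𝟙 P? * 𝟙 Q? ≡ 𝟙 R? * 𝟙 P?
𝟙-*-cong (yes p) Q? R? f g = trans (*-identityˡ (𝟙 Q?))
  (trans (𝟙-cong Q? R? (f p) (g p)) (sym (*-identityʳ (𝟙 R?))))
𝟙-*-cong (no _)  Q? R? f g = sym (*-zeroʳ (𝟙 R?))

IsBit : ℕ → Set
IsBit x = x ≡ 0 ⊎ x ≡ 1

𝟙-isBit : (P? : Dec P) → IsBit (𝟙 P?)
𝟙-isBit (yes _) = inj₂ refl
𝟙-isBit (no _)  = inj₁ refl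

𝟙-bit : ∀ {x} (P? : Dec P) → IsBit x → (P → x ≡ 1) → (x ≡ 1 → P) → 𝟙 P? ≡ x
𝟙-bit P? (inj₁ refl) f g = 𝟙-no P? λ p → contradiction (f p) λ ()
𝟙-bit P? (inj₂ refl) f g = 𝟙-yes P? (g refl)

disjoint-bits-+ : ∀ {x y} → IsBit x → IsBit y → x * y ≡ 0 → IsBit (x + y)
disjoint-bits-+ (inj₁ refl) y-bit       _  = y-bit
disjoint-bits-+ (inj₂ refl) (inj₁ refl) _  = inj₂ refl
disjoint-bits-+ (inj₂ refl) (inj₂ refl) ()

sum-𝟙-≟ : ∀ {n} (i : Fin n) → ∑[ k < n ] 𝟙 (i Fin.≟ k) ≡ 1
sum-𝟙-≟ {suc n} zero    = cong suc (sum-replicate-zero n)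
sum-𝟙-≟ {suc n} (suc i) = trans
  (sum-cong-≗ λ k → 𝟙-cong (suc i Fin.≟ suc k) (i Fin.≟ k) Fin.suc-injective (cong suc))
  (sum-𝟙-≟ i)

count-tabulate : ∀ {a} {A : Set a} {P : Pred A p} (P? : Decidable P) (f : Fin n → A) →
                 count P? (tabulate f) ≡ ∑[ j < n ] 𝟙 (P? (f j))
count-tabulate {n = zero}  P? f = refl
count-tabulate {n = suc n} P? f with does (P? (f zero))
... | true  = cong suc (count-tabulate P? (f ∘ suc))
... | false = count-tabulate P? (f ∘ suc)

-- Balanced incomplete block designs from (0,1)-matrices

module _ {v b} (N : Matrix ℕ v b) (bit : ∀ i j → IsBit (N i j)) where

  private
    B : Fin b → Subset v
    B j = tabulate λ i → does (N i j ≟ 1)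

    does≡true⇒ : ∀ x → does (x ≟ 1) ≡ true → x ≡ 1
    does≡true⇒ 1 _ = refl

    ∈⇒≡1 : ∀ i j → i ∈ B j → N i j ≡ 1
    ∈⇒≡1 i j i∈B = does≡true⇒ (N i j) (trans (sym (lookup∘tabulate _ i)) ([]=⇒lookup i∈B))

    ≡1⇒∈ : ∀ i j → N i j ≡ 1 → i ∈ B j
    ≡1⇒∈ i j eq = lookup⇒[]= i (B j) (trans (lookup∘tabulate _ i) (cong (λ x → does (x ≟ 1)) eq))

    𝟙-∈? : ∀ i j → 𝟙 (i ∈? B j) ≡ N i j
    𝟙-∈? i j = 𝟙-bit (i ∈? B j) (bit i j) (∈⇒≡1 i j) (≡1⇒∈ i j)

  -- As the entries are bits, `N i j` is itself the indicator of membership and a product of two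
  -- entries that of joint membership. Each count in the definition of a design thus becomes a sum
  -- of entries.
  isBIBDMatrix : ∀ {r k μ} →
    (∀ j → ∑[ i < v ] N i j ≡ k) →
    (∀ i → ∑[ j < b ] N i j ≡ r) →
    (∀ i₁ i₂ → i₁ ≢ i₂ → ∑[ j < b ] (N i₁ j * N i₂ j) ≡ μ) →
    IsBIBDMatrix v b r k μ N
  isBIBDMatrix size rep bal = B , record
    { isBlockDesign = record
      -- The size of a subset is by definition the count of `inside` in its vector, so
      -- `count-tabulate` applies directly.
      { blockSize = λ j → trans (count-tabulate (Bool._≟ inside) λ i → does (N i j ≟ 1))
          (trans (sum-cong-≗ λ i → 𝟙-bit (does (N i j ≟ 1) Bool.≟ true) (bit i j)
                    (does≡true⇒ (N i j)) (cong λ x → does (x ≟ 1)))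
                 (size j))
      ; replication = λ i → trans (count-tabulate (λ j → i ∈? B j) id)
          (trans (sum-cong-≗ (𝟙-∈? i)) (rep i))
      }
    ; balance = λ i₁ i₂ i₁≢i₂ →
        trans (count-tabulate (λ j → (i₁ ∈? B j) ×-dec (i₂ ∈? B j)) id)
          (trans (sum-cong-≗ λ j → trans (𝟙-× (i₁ ∈? B j) (i₂ ∈? B j))
                                         (cong₂ _*_ (𝟙-∈? i₁ j) (𝟙-∈? i₂ j)))
                 (bal i₁ i₂ i₁≢i₂))
    } , λ i j → bit i j , mk⇔ (≡1⇒∈ i j) (∈⇒≡1 i j)

-- Differences and occurrence counts in a finite abelian group

module _ {c ℓ n} (G : FiniteAbelianGroup c ℓ n) where
  open FiniteAbelianGroup G
    using (Carrier; _≈_; _≈?_; _∙_; ε; _⁻¹; _-_; abelianGroup; enumeration;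
           assoc; comm; ∙-cong; ∙-congˡ; ∙-congʳ; ⁻¹-cong; identityʳ)
    renaming (inverseʳ to ⁻¹-inverseʳ; refl to ≈-refl; sym to ≈-sym; trans to ≈-trans)
  open AbelianGroupProperties abelianGroup
    using (⁻¹-anti-homo‿-; ⁻¹-involutive; ε⁻¹≈ε; x∙y⁻¹≈ε⇒x≈y; //-rightDividesˡ; //-rightDividesʳ)
  open Inverse enumeration using (to; to-cong; inverseˡ; inverseʳ) renaming (from to element)

  private
    x-y≈z⇒x≈z∙y : ∀ {x y z} → x - y ≈ z → x ≈ z ∙ y
    x-y≈z⇒x≈z∙y {x} {y} eq = ≈-trans (≈-sym (//-rightDividesˡ y x)) (∙-congʳ eq)

    x≈z∙y⇒x-y≈z : ∀ {x y z} → x ≈ z ∙ y → x - y ≈ z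
    x≈z∙y⇒x-y≈z {y = y} {z} eq = ≈-trans (∙-congʳ eq) (//-rightDividesʳ y z)

    -‿∙-comm : ∀ x y z → (x - y) ∙ z ≈ (x ∙ z) - y
    -‿∙-comm x y z = ≈-trans (assoc x (y ⁻¹) z)
      (≈-trans (∙-congˡ (comm (y ⁻¹) z)) (≈-sym (assoc x z (y ⁻¹))))

    -- Both equations say `x ∙ w ≈ y ∙ z`; commutativity is essential. For the four entries in two
    -- rows and two columns this exchanges the roles of rows and columns.
    swap-differences : ∀ {x y z w} → x - y ≈ z - w → x - z ≈ y - w
    swap-differences {x} {y} {z} {w} eq = x≈z∙y⇒x-y≈z
      (≈-trans (x-y≈z⇒x≈z∙y eq)
      (≈-trans (-‿∙-comm z w y)
      (≈-trans (∙-congʳ (comm z y))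
      (≈-sym (-‿∙-comm y w z)))))

    x-ε≈x : ∀ x → x - ε ≈ x
    x-ε≈x x = ≈-trans (∙-congˡ ε⁻¹≈ε) (identityʳ x)

    swap-subtrahend : ∀ {x y z} → x - y ≈ z → x - z ≈ y
    swap-subtrahend {y = y} {z} eq =
      ≈-trans (swap-differences (≈-trans eq (≈-sym (x-ε≈x z)))) (x-ε≈x y)

    -- An instance of `swap-differences`, since `(x - z) - x` and `(y - z) - y` are both `z ⁻¹`.
    -‿cancelʳ : ∀ x y z → (x - z) - (y - z) ≈ x - y
    -‿cancelʳ x y z = swap-differences {x - z} {x} {y - z} {y}
      (≈-trans (x≈z∙y⇒x-y≈z {x - z} (comm x (z ⁻¹))) (≈-sym (x≈z∙y⇒x-y≈z {y - z} (comm y (z ⁻¹)))))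

    -‿cong : ∀ {x y z w} → x ≈ y → z ≈ w → x - z ≈ y - w
    -‿cong eq eq′ = ∙-cong eq (⁻¹-cong eq′)

    element-injective : ∀ {h k} → element h ≈ element k → h ≡ k
    element-injective {h} {k} eq =
      trans (sym (inverseˡ ≈-refl)) (trans (to-cong eq) (inverseˡ ≈-refl))

    δ : Carrier → Carrier → ℕ
    δ x y = 𝟙 (x ≈? y)

    δ-iff : ∀ {x y z w} → (x ≈ y → z ≈ w) → (z ≈ w → x ≈ y) → δ x y ≡ δ z w
    δ-iff {x} {y} {z} {w} = 𝟙-cong (x ≈? y) (z ≈? w)

    δ-cong : ∀ {x y z w} → x ≈ z → y ≈ w → δ x y ≡ δ z w
    δ-cong x≈z y≈w = δ-iff
      (λ x≈y → ≈-trans (≈-sym x≈z) (≈-trans x≈y y≈w))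
      (λ z≈w → ≈-trans x≈z (≈-trans z≈w (≈-sym y≈w)))

    sum-δ : ∀ x → ∑[ k < n ] δ x (element k) ≡ 1
    sum-δ x = trans
      (sum-cong-≗ λ k → 𝟙-cong (x ≈? element k) (to x Fin.≟ k)
        inverseˡ (λ eq → ≈-sym (inverseʳ (sym eq))))
      (sum-𝟙-≟ (to x))

    δ-*-δ : ∀ x y z → δ x z * δ y z ≡ δ x y * δ x z
    δ-*-δ x y z = 𝟙-*-cong (x ≈? z) (y ≈? z) (x ≈? y)
      (λ x≈z y≈z → ≈-trans x≈z (≈-sym y≈z)) (λ x≈z x≈y → ≈-trans (≈-sym x≈y) x≈z)

    -- Eliminates the common value: only the index of `x` can contribute, and there the second
    -- factor tests whether `y` is the same element.
    sum-δ-*-δ : ∀ x y → ∑[ k < n ] (δ x (element k) * δ y (element k)) ≡ δ x y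
    sum-δ-*-δ x y = begin
      ∑[ k < n ] (δ x (element k) * δ y (element k)) ≡⟨ sum-cong-≗ (λ k → δ-*-δ x y (element k)) ⟩
      ∑[ k < n ] (δ x y * δ x (element k))           ≡⟨ *-distribˡ-sum (δ x y) (δ x ∘ element) ⟨
      δ x y * ∑[ k < n ] δ x (element k)             ≡⟨ cong (δ x y *_) (sum-δ x) ⟩
      δ x y * 1                                      ≡⟨ *-identityʳ (δ x y) ⟩
      δ x y                                          ∎
      where open ≡-Reasoning

    -- The squared fibre sizes of `f` count the ordered pairs of indices with equal values: expand
    -- each square and sum over `k` first.
    sum-occurrences² : (f : Fin m → Carrier) →
      ∑[ k < n ] (∑[ j < m ] δ (f j) (element k) * ∑[ j < m ] δ (f j) (element k)) ≡
      ∑[ j < m ] ∑[ j′ < m ] δ (f j) (f j′)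
    sum-occurrences² {m} f = begin
      ∑[ k < n ] (∑[ j < m ] d j k * ∑[ j < m ] d j k)
        ≡⟨ sum-cong-≗ (λ k → sum-*-sum (λ j → d j k) (λ j → d j k)) ⟩
      ∑[ k < n ] ∑[ j < m ] ∑[ j′ < m ] (d j k * d j′ k)
        ≡⟨ ∑-comm (λ k j → ∑[ j′ < m ] (d j k * d j′ k)) ⟩
      ∑[ j < m ] ∑[ k < n ] ∑[ j′ < m ] (d j k * d j′ k)
        ≡⟨ sum-cong-≗ (λ j → ∑-comm λ k j′ → d j k * d j′ k) ⟩
      ∑[ j < m ] ∑[ j′ < m ] ∑[ k < n ] (d j k * d j′ k)
        ≡⟨ ∑₂-cong (λ j j′ → sum-δ-*-δ (f j) (f j′)) ⟩
      ∑[ j < m ] ∑[ j′ < m ] δ (f j) (f j′) ∎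
      where
      open ≡-Reasoning
      d : Fin m → Fin n → ℕ
      d j k = δ (f j) (element k)

  -- Transposing a generalized Hadamard matrix

  -- Unlike in `IsDifferenceMatrix`, the two rows come in either order and the width `l` is not tied
  -- to `n * μ`, so the property can be stated for a transpose and for a matrix of size `suc m`.
  HasBalancedRows : ∀ {k l} → ℕ → Matrix Carrier k l → Set c
  HasBalancedRows {l = l} μ A = ∀ i₁ i₂ → i₁ ≢ i₂ → ∀ g →
    ∑[ j < l ] δ (A i₁ j - A i₂ j) g ≡ μ

  differenceMatrix⇒balancedRows : ∀ {k μ} {A : Matrix Carrier k (n * μ)} →
    IsDifferenceMatrix G k μ A → HasBalancedRows μ A
  differenceMatrix⇒balancedRows {A = A} isDM i₁ i₂ i₁≢i₂ g with Fin.<-cmp i₁ i₂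
  ... | tri< i₁<i₂ _ _ = trans (sym (count-tabulate (_≈? g) λ j → A i₁ j - A i₂ j)) (isDM i₁ i₂ i₁<i₂ g)
  ... | tri≈ _ i₁≡i₂ _ = contradiction i₁≡i₂ i₁≢i₂
  -- Exchanging the rows inverts every difference, so `g` occurs as often as `g ⁻¹` does in the
  -- opposite order.
  ... | tri> _ _ i₂<i₁ = trans
    (sum-cong-≗ λ j → δ-iff
      (λ eq → ≈-trans (≈-sym (⁻¹-anti-homo‿- (A i₁ j) (A i₂ j))) (⁻¹-cong eq))
      (λ eq → ≈-trans (≈-sym (⁻¹-anti-homo‿- (A i₂ j) (A i₁ j)))
                      (≈-trans (⁻¹-cong eq) (⁻¹-involutive g))))
    (trans (sym (count-tabulate (_≈? (g ⁻¹)) λ j → A i₂ j - A i₁ j)) (isDM i₂ i₁ i₂<i₁ (g ⁻¹)))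

  -- The size is linked to `n * μ` by an equation, so that it may later be a successor.
  transpose-balanced : ∀ {μ} (A : Matrix Carrier m m) → m ≡ n * μ →
    HasBalancedRows μ A → HasBalancedRows μ (λ j i → A i j)
  transpose-balanced {m} {μ} A m≡nμ rows j₁ j₂ j₁≢j₂ g = begin
    ∑[ i < m ] δ (A i j₁ - A i j₂) g
      ≡⟨ sum-cong-≗ (λ i → δ-cong {A i j₁ - A i j₂} ≈-refl (≈-sym (inverseʳ refl))) ⟩
    occurrences Aᵀ j₁ j₂ (to g)
      ≡⟨ variance≡0 (occurrences Aᵀ) expected occurrences*expected Σ-occurrences² j₁ j₂ (to g) ⟩
    expected j₁ j₂ (to g)
      ≡⟨ expected-≢ j₁≢j₂ (to g) ⟩
    μ ∎
    where
    open ≡-Reasoning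

    Aᵀ : Matrix Carrier m m
    Aᵀ j i = A i j

    occurrences : Matrix Carrier m m → Fin m → Fin m → Fin n → ℕ
    occurrences M i₁ i₂ k = ∑[ j < m ] δ (M i₁ j - M i₂ j) (element k)

    -- On the diagonal every difference is `ε`, so the value is `m` at the identity and zero
    -- elsewhere. Covering the diagonal lets the sums of squares run over all pairs of indices.
    expected : Fin m → Fin m → Fin n → ℕ
    expected i₁ i₂ k = if does (i₁ Fin.≟ i₂) then ∑[ j < m ] δ ε (element k) else μ

    expected-≢ : ∀ {i₁ i₂} → i₁ ≢ i₂ → ∀ k → expected i₁ i₂ k ≡ μ
    expected-≢ {i₁} {i₂} i₁≢i₂ k with i₁ Fin.≟ i₂
    ... | yes i₁≡i₂ = contradiction i₁≡i₂ i₁≢i₂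
    ... | no _      = refl

    occurrences-diagonal : ∀ M i k → occurrences M i i k ≡ ∑[ j < m ] δ ε (element k)
    occurrences-diagonal M i k = sum-cong-≗ λ j → δ-cong (⁻¹-inverseʳ (M i j)) ≈-refl

    row-occurrences : ∀ i₁ i₂ k → occurrences A i₁ i₂ k ≡ expected i₁ i₂ k
    row-occurrences i₁ i₂ k with i₁ Fin.≟ i₂
    ... | yes refl  = occurrences-diagonal A i₁ k
    ... | no  i₁≢i₂ = rows i₁ i₂ i₁≢i₂ (element k)

    Σ-occurrences : ∀ M i₁ i₂ → ∑[ k < n ] occurrences M i₁ i₂ k ≡ n * μ
    Σ-occurrences M i₁ i₂ = begin
      ∑[ k < n ] occurrences M i₁ i₂ k                    ≡⟨ ∑-comm (λ k j → δ (M i₁ j - M i₂ j) (element k)) ⟩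
      ∑[ j < m ] ∑[ k < n ] δ (M i₁ j - M i₂ j) (element k) ≡⟨ sum-cong-≗ (λ j → sum-δ (M i₁ j - M i₂ j)) ⟩
      ∑[ j < m ] 1                                        ≡⟨ sum-const m 1 ⟩
      m * 1                                               ≡⟨ *-identityʳ m ⟩
      m                                                   ≡⟨ m≡nμ ⟩
      n * μ                                               ∎

    -- The orthogonality required by `variance≡0`. On the diagonal both functions coincide; off it
    -- the expected value is constant, so only the total number `n * μ` of occurrences matters, and
    -- this is known for columns as well as for rows.
    occurrences*expected : ∀ j₁ j₂ →
      ∑[ k < n ] (occurrences Aᵀ j₁ j₂ k * expected j₁ j₂ k) ≡
      ∑[ k < n ] (expected j₁ j₂ k * expected j₁ j₂ k)
    occurrences*expected j₁ j₂ with j₁ Fin.≟ j₂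
    ... | yes refl = sum-cong-≗ λ k → cong (_* _) (occurrences-diagonal Aᵀ j₁ k)
    ... | no  _    = begin
      ∑[ k < n ] (occurrences Aᵀ j₁ j₂ k * μ) ≡⟨ *-distribʳ-sum μ (occurrences Aᵀ j₁ j₂) ⟨
      sum (occurrences Aᵀ j₁ j₂) * μ          ≡⟨ cong (_* μ) (Σ-occurrences Aᵀ j₁ j₂) ⟩
      n * μ * μ                               ≡⟨ *-assoc n μ μ ⟩
      n * (μ * μ)                             ≡⟨ sum-const n (μ * μ) ⟨
      ∑[ k < n ] (μ * μ)                      ∎

    Σ-occurrences² :
      ∑[ j₁ < m ] ∑[ j₂ < m ] ∑[ k < n ] (occurrences Aᵀ j₁ j₂ k * occurrences Aᵀ j₁ j₂ k) ≡
      ∑[ i₁ < m ] ∑[ i₂ < m ] ∑[ k < n ] (expected i₁ i₂ k * expected i₁ i₂ k)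
    Σ-occurrences² = begin
      ∑[ j₁ < m ] ∑[ j₂ < m ] ∑[ k < n ] (occurrences Aᵀ j₁ j₂ k * occurrences Aᵀ j₁ j₂ k)
        ≡⟨ ∑₂-cong (λ j₁ j₂ → sum-occurrences² λ i → A i j₁ - A i j₂) ⟩
      ∑[ j₁ < m ] ∑[ j₂ < m ] ∑[ i₁ < m ] ∑[ i₂ < m ] δ (A i₁ j₁ - A i₁ j₂) (A i₂ j₁ - A i₂ j₂)
        -- The transposition: `swap-differences` undoes itself, so it serves for both directions.
        ≡⟨ ∑₂-cong (λ j₁ j₂ → ∑₂-cong λ i₁ i₂ →
             δ-iff {A i₁ j₁ - A i₁ j₂} {A i₂ j₁ - A i₂ j₂} swap-differences swap-differences) ⟩
      ∑[ j₁ < m ] ∑[ j₂ < m ] ∑[ i₁ < m ] ∑[ i₂ < m ] δ (A i₁ j₁ - A i₂ j₁) (A i₁ j₂ - A i₂ j₂)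
        ≡⟨ ∑₂-interchange (λ j₁ j₂ i₁ i₂ → δ (A i₁ j₁ - A i₂ j₁) (A i₁ j₂ - A i₂ j₂)) ⟩
      ∑[ i₁ < m ] ∑[ i₂ < m ] ∑[ j₁ < m ] ∑[ j₂ < m ] δ (A i₁ j₁ - A i₂ j₁) (A i₁ j₂ - A i₂ j₂)
        ≡⟨ ∑₂-cong (λ i₁ i₂ → sum-occurrences² λ j → A i₁ j - A i₂ j) ⟨
      ∑[ i₁ < m ] ∑[ i₂ < m ] ∑[ k < n ] (occurrences A i₁ i₂ k * occurrences A i₁ i₂ k)
        ≡⟨ ∑₂-cong (λ i₁ i₂ → sum-cong-≗ λ k → cong₂ _*_ (row-occurrences i₁ i₂ k) (row-occurrences i₁ i₂ k)) ⟩
      ∑[ i₁ < m ] ∑[ i₂ < m ] ∑[ k < n ] (expected i₁ i₂ k * expected i₁ i₂ k) ∎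

  -- The pairwise additive designs

  module _ {m μ} (A : Matrix Carrier (suc m) (suc m)) (1+m≡n*1+μ : suc m ≡ n * suc μ)
           (rows : HasBalancedRows (suc μ) A) where

    private
      normalized : Matrix Carrier (suc m) (suc m)
      normalized i j = A i j - A zero j

      -- The subtracted row cancels in differences of rows, so the rows stay balanced, and
      -- `transpose-balanced` carries this over to the columns.
      normalized-columns : HasBalancedRows (suc μ) (λ j i → normalized i j)
      normalized-columns = transpose-balanced normalized 1+m≡n*1+μ λ i₁ i₂ i₁≢i₂ g →
        trans (sum-cong-≗ λ j → δ-cong (-‿cancelʳ (A i₁ j) (A i₂ j) (A zero j)) (≈-refl {g}))
              (rows i₁ i₂ i₁≢i₂ g)

      incidence : Fin n → Fin (suc m) → Fin n × Fin m → ℕ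
      incidence h j (g , i) = δ (element h - normalized (suc i) j) (element g)

      N : Fin n → Matrix ℕ (suc m) (n * m)
      N h j s = incidence h j (remQuot m s)

      N-isBit : ∀ h j s → IsBit (N h j s)
      N-isBit h j s = 𝟙-isBit (_ ≈? _)

      -- Membership of `j` means that `A (suc i) j - A zero j` equals `element h - element g`, so
      -- this is the balance of the rows `suc i` and `zero` of `A`. The omitted first row would
      -- yield only empty or full blocks.
      incidence-size : ∀ h s → ∑[ j < suc m ] incidence h j s ≡ suc μ
      incidence-size h (g , i) = trans (sum-cong-≗ λ j → δ-iff {element h - normalized (suc i) j} {element g}
              (λ eq → ≈-sym (swap-subtrahend eq))
              (λ eq → swap-subtrahend (≈-sym eq)))
            (rows (suc i) zero (λ ()) (element h - element g))

      N-size : ∀ h s → ∑[ j < suc m ] N h j s ≡ suc μ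
      N-size h s = incidence-size h (remQuot m s)

      -- For each row `i` exactly one label `g` fits, so a point lies in one block per row.
      N-replication : ∀ h j → ∑[ s < n * m ] N h j s ≡ m
      N-replication h j = begin
        ∑[ s < n * m ] N h j s                     ≡⟨ sum-remQuot n m (incidence h j) ⟩
        ∑[ g < n ] ∑[ i < m ] incidence h j (g , i) ≡⟨ ∑-comm (λ g i → incidence h j (g , i)) ⟩
        ∑[ i < m ] ∑[ g < n ] incidence h j (g , i) ≡⟨ sum-cong-≗ (λ i → sum-δ (element h - normalized (suc i) j)) ⟩
        ∑[ i < m ] 1                               ≡⟨ sum-const m 1 ⟩
        m * 1                                      ≡⟨ *-identityʳ m ⟩
        m                                          ∎
        where open ≡-Reasoning

      -- The indicator on the left is the contribution of the first row of the
      -- normalized matrix, which is zero.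
      N-product : ∀ h₁ h₂ j₁ j₂ → j₁ ≢ j₂ →
        𝟙 (h₁ Fin.≟ h₂) + ∑[ s < n * m ] (N h₁ j₁ s * N h₂ j₂ s) ≡ suc μ
      N-product h₁ h₂ j₁ j₂ j₁≢j₂ = begin
        𝟙 (h₁ Fin.≟ h₂) + ∑[ s < n * m ] (N h₁ j₁ s * N h₂ j₂ s)
          ≡⟨ cong₂ _+_ first-row other-rows ⟩
        ∑[ i < suc m ] δ (normalized i j₁ - normalized i j₂) (element h₁ - element h₂)
          ≡⟨ normalized-columns j₁ j₂ j₁≢j₂ (element h₁ - element h₂) ⟩
        suc μ ∎
        where
        open ≡-Reasoning
        zero-difference : normalized zero j₁ - normalized zero j₂ ≈ ε
        zero-difference = ≈-trans
          (-‿cong (⁻¹-inverseʳ (A zero j₁)) (⁻¹-inverseʳ (A zero j₂)))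
          (x-ε≈x ε)
        first-row : 𝟙 (h₁ Fin.≟ h₂) ≡ δ (normalized zero j₁ - normalized zero j₂) (element h₁ - element h₂)
        first-row = 𝟙-cong (h₁ Fin.≟ h₂) (_ ≈? _)
          (λ { refl → ≈-trans zero-difference (≈-sym (⁻¹-inverseʳ (element h₁))) })
          (λ eq → element-injective (x∙y⁻¹≈ε⇒x≈y _ _ (≈-trans (≈-sym eq) zero-difference)))
        -- Summing over `g` leaves, for each row, the condition that both points get the same label;
        -- `swap-differences` rewrites it as a condition on the difference of the two columns.
        other-rows : ∑[ s < n * m ] (N h₁ j₁ s * N h₂ j₂ s) ≡
          ∑[ i < m ] δ (normalized (suc i) j₁ - normalized (suc i) j₂) (element h₁ - element h₂)
        other-rows = begin
          ∑[ s < n * m ] (N h₁ j₁ s * N h₂ j₂ s)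
            ≡⟨ sum-remQuot n m (λ s → incidence h₁ j₁ s * incidence h₂ j₂ s) ⟩
          ∑[ g < n ] ∑[ i < m ] (incidence h₁ j₁ (g , i) * incidence h₂ j₂ (g , i))
            ≡⟨ ∑-comm (λ g i → incidence h₁ j₁ (g , i) * incidence h₂ j₂ (g , i)) ⟩
          ∑[ i < m ] ∑[ g < n ] (incidence h₁ j₁ (g , i) * incidence h₂ j₂ (g , i))
            ≡⟨ sum-cong-≗ (λ i → sum-δ-*-δ (element h₁ - normalized (suc i) j₁)
                                             (element h₂ - normalized (suc i) j₂)) ⟩
          ∑[ i < m ] δ (element h₁ - normalized (suc i) j₁) (element h₂ - normalized (suc i) j₂)
            ≡⟨ sum-cong-≗ (λ i → δ-iff {element h₁ - normalized (suc i) j₁} {element h₂ - normalized (suc i) j₂}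
                 (≈-sym ∘ swap-differences) (swap-differences ∘ ≈-sym)) ⟩
          ∑[ i < m ] δ (normalized (suc i) j₁ - normalized (suc i) j₂) (element h₁ - element h₂) ∎

      -- For equal `h` the target difference is the identity, so the omitted first row takes one of
      -- the `suc μ` occurrences.
      N-balance : ∀ h j₁ j₂ → j₁ ≢ j₂ → ∑[ s < n * m ] (N h j₁ s * N h j₂ s) ≡ μ
      N-balance h j₁ j₂ j₁≢j₂ = suc-injective
        (trans (cong (_+ ∑[ s < n * m ] (N h j₁ s * N h j₂ s)) (sym (𝟙-yes (h Fin.≟ h) refl)))
          (N-product h h j₁ j₂ j₁≢j₂))

      -- For distinct `h₁` and `h₂` the target difference is not the identity, so the omitted first
      -- row takes none.
      N-cross-balance : ∀ {h₁ h₂} → h₁ ≢ h₂ → ∀ j₁ j₂ → j₁ ≢ j₂ →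
        ∑[ s < n * m ] (N h₁ j₁ s * N h₂ j₂ s) ≡ suc μ
      N-cross-balance {h₁} {h₂} h₁≢h₂ j₁ j₂ j₁≢j₂ =
        trans (cong (_+ ∑[ s < n * m ] (N h₁ j₁ s * N h₂ j₂ s)) (sym (𝟙-no (h₁ Fin.≟ h₂) h₁≢h₂)))
          (N-product h₁ h₂ j₁ j₂ j₁≢j₂)

      -- Both labels subtract the same entry; if they agree, it cancels and forces `h₁ ≡ h₂`.
      incidence-disjoint : ∀ h₁ h₂ → h₁ ≢ h₂ → ∀ j s → incidence h₁ j s * incidence h₂ j s ≡ 0
      incidence-disjoint h₁ h₂ h₁≢h₂ j (g , i) = trans (δ-*-δ _ _ (element g))
        (cong (_* _) (𝟙-no (_ ≈? _) λ eq →
          h₁≢h₂ (element-injective (x∙y⁻¹≈ε⇒x≈y _ _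
            (≈-trans (swap-differences eq) (⁻¹-inverseʳ (normalized (suc i) j)))))))

      N-disjoint : ∀ h₁ h₂ → h₁ ≢ h₂ → ∀ j s → N h₁ j s * N h₂ j s ≡ 0
      N-disjoint h₁ h₂ h₁≢h₂ j s = incidence-disjoint h₁ h₂ h₁≢h₂ j (remQuot m s)

      -- Of the four products, the two with equal designs give `μ` each and the two mixed ones
      -- `suc μ` each.
      N-sum-balance : ∀ {h₁ h₂} → h₁ ≢ h₂ → ∀ j₁ j₂ → j₁ ≢ j₂ →
        ∑[ s < n * m ] ((N h₁ j₁ s + N h₂ j₁ s) * (N h₁ j₂ s + N h₂ j₂ s)) ≡ 2 * (2 * suc μ ∸ 1)
      N-sum-balance {h₁} {h₂} h₁≢h₂ j₁ j₂ j₁≢j₂ = begin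
        ∑[ s < n * m ] ((N h₁ j₁ s + N h₂ j₁ s) * (N h₁ j₂ s + N h₂ j₂ s))
          ≡⟨ sum-cong-≗ (λ s → expand (N h₁ j₁ s) (N h₂ j₁ s) (N h₁ j₂ s) (N h₂ j₂ s)) ⟩
        ∑[ s < n * m ] ((X h₁ h₁ s + X h₁ h₂ s) + (X h₂ h₁ s + X h₂ h₂ s))
          ≡⟨ ∑-distrib-+ (λ s → X h₁ h₁ s + X h₁ h₂ s) (λ s → X h₂ h₁ s + X h₂ h₂ s) ⟩
        ∑[ s < n * m ] (X h₁ h₁ s + X h₁ h₂ s) + ∑[ s < n * m ] (X h₂ h₁ s + X h₂ h₂ s)
          ≡⟨ cong₂ _+_ (∑-distrib-+ (X h₁ h₁) (X h₁ h₂)) (∑-distrib-+ (X h₂ h₁) (X h₂ h₂)) ⟩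
        (sum (X h₁ h₁) + sum (X h₁ h₂)) + (sum (X h₂ h₁) + sum (X h₂ h₂))
          ≡⟨ cong₂ _+_
              (cong₂ _+_ (N-balance h₁ j₁ j₂ j₁≢j₂) (N-cross-balance h₁≢h₂ j₁ j₂ j₁≢j₂))
              (cong₂ _+_ (N-cross-balance (h₁≢h₂ ∘ sym) j₁ j₂ j₁≢j₂) (N-balance h₂ j₁ j₂ j₁≢j₂)) ⟩
        (μ + suc μ) + (suc μ + μ)
          ≡⟨ collect μ ⟩
        2 * (2 * suc μ ∸ 1) ∎
        where
        open ≡-Reasoning
        X : Fin n → Fin n → Fin (n * m) → ℕ
        X h h′ s = N h j₁ s * N h′ j₂ s
        expand : ∀ a b c d → (a + b) * (c + d) ≡ (a * c + a * d) + (b * c + b * d)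
        expand = solve-∀
        -- The right side is what `2 * (2 * suc x ∸ 1)` reduces to once `∸` has computed, a form the
        -- ring solver accepts.
        collect : ∀ x → (x + suc x) + (suc x + x) ≡ 2 * (x + suc (x + 0))
        collect = solve-∀

    fullPAB : FullPAB (suc m) (n * m) m (suc μ) μ
    fullPAB = n , N , sym 1+m≡n*1+μ , record
      { isBIBD   = λ h → isBIBDMatrix (N h) (N-isBit h) (N-size h) (N-replication h) (N-balance h)
      ; disjoint = N-disjoint
      -- Here `r` and `v ∸ 1` are both `m`, so they cancel in the quotient and leave
      -- `2 * (2 * k ∸ 1)` with `k = suc μ`.
      ; additive = λ h₁ h₂ h₁≢h₂ → 2 * (2 * suc μ ∸ 1) , index m (2 * suc μ ∸ 1) ,
          isBIBDMatrix (λ j s → N h₁ j s + N h₂ j s)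
            (λ j s → disjoint-bits-+ (N-isBit h₁ j s) (N-isBit h₂ j s) (N-disjoint h₁ h₂ h₁≢h₂ j s))
            (λ s → trans (∑-distrib-+ (λ j → N h₁ j s) (λ j → N h₂ j s))
                         (double (N-size h₁ s) (N-size h₂ s)))
            (λ j → trans (∑-distrib-+ (N h₁ j) (N h₂ j))
                         (double (N-replication h₁ j) (N-replication h₂ j)))
            (N-sum-balance h₁≢h₂)
      }
      where
      double : ∀ {x y z} → x ≡ z → y ≡ z → x + y ≡ 2 * z
      double {z = z} refl refl = cong (z +_) (sym (+-identityʳ z))
      index : ∀ x y → 2 * y * x ≡ 2 * x * y
      index = solve-∀

  -- Being nonzero, the size and the index can be matched as successors, and then the truncated
  -- subtractions compute.
  balancedRows⇒fullPAB : ∀ {m μ} .{{_ : NonZero m}} .{{_ : NonZero μ}} → m ≡ n * μ →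
    (A : Matrix Carrier m m) → HasBalancedRows μ A → FullPAB m (n * (m ∸ 1)) (m ∸ 1) μ (μ ∸ 1)
  balancedRows⇒fullPAB {suc m} {suc μ} m≡nμ A rows = fullPAB A m≡nμ rows

theorem4p3 : ∀ {c ℓ} (n μ : ℕ) .{{_ : NonZero n}} .{{_ : NonZero μ}} →
    GH c ℓ n μ →
    FullPAB (n * μ) (n * (n * μ ∸ 1)) (n * μ ∸ 1) μ (μ ∸ 1)
theorem4p3 n μ (G , A , isGH) =
  balancedRows⇒fullPAB G {{m*n≢0 n μ}} refl A (differenceMatrix⇒balancedRows G {A = A} isGH)
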